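{- Let $(G,\mathcal{C})$ be a 2-colored graph, $G=(V,E)$, and $l,u:E\to\mathbb{N}$ with $l\le u$. Suppose $f\in\mathcal{A}(G,\mathcal{C})\cap\mathbb{N}^E$ is infeasible, but $\mathcal{A}(G,\mathcal{C})\cap\mathbb{N}^E$ contains a feasible vector. Then for each $e\in E$: (i) if $f(e)<l(e)$, then $G(f)$ has a CAT through $e_1$; (ii) if $f(e)>u(e)$, then $G(f)$ has a CAT through $e_3$.
   Context: Graphs are finite, undirected, may have parallel edges but no loops; $\mathcal{C}:E\to\{R,B\}$ is a red/blue coloring. The alternating cone $\mathcal{A}(G,\mathcal{C})\subseteq\mathbb{R}^E$ consists of $x\ge0$ with, at every vertex, the sum of $x$ over incident red edges equal to the sum over incident blue edges. A vector $f\in\mathcal{A}(G,\mathcal{C})$ is feasible if $l(e)\le f(e)\le u(e)$ for all $e$, infeasible otherwise. The residual 2-colored graph $G(f)=(V,E(f))$ of $f\in\mathcal{A}(G,\mathcal{C})\cap\mathbb{N}^E$ w.r.t. $l,u$: take four disjoint copies $e_1,e_2,e_3,e_4$ of each $e\in E$ (each with the same endpoints as $e$); $e_1\in E(f)$ with color $\mathcal{C}(e)$ iff $f(e)\le u(e)-1$; $e_2\in E(f)$ with color $\mathcal{C}(e)$ iff $f(e)\le u(e)-2$; $e_3\in E(f)$ with the color opposite to $\mathcal{C}(e)$ iff $f(e)\ge l(e)+1$; $e_4\in E(f)$ with the color opposite to $\mathcal{C}(e)$ iff $f(e)\ge l(e)+2$. A CAT (closed alternating trail) is a walk $(v_0,a_1,v_1,\dots,a_m,v_m)$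 with $v_0=v_m$, distinct edges $a_1,\dots,a_m$, consecutive edges of different colors, and $a_m$, $a_1$ of different colors; it is through an edge if that edge is among the $a_j$. -}

module Defs where

open import Data.Fin using (Fin)
open import Data.Fin.Properties using () renaming (_≟_ to _≟ᶠ_)
open import Data.List using (List; []; _∷_; map; filter; allFin; head; last)
open import Data.List.Membership.Propositional using (_∈_)
open import Data.List.Relation.Unary.Linked using (Linked)
open import Data.List.Relation.Unary.Unique.Propositional using (Unique)
open import Data.Maybe.Relation.Binary.Connected using (Connected)
open import Data.Nat using (ℕ; _+_; _≤_)
open import Data.Nat.ListAction using (sum)
open import Data.Product using (Σ; Σ-syntax; _×_; _,_; proj₁; proj₂)
open import Data.Sum using (_⊎_)
open import Relation.Binary.PropositionalEquality using (_≡_; _≢_; refl)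
open import Relation.Nullary using (Dec; yes; no; _×-dec_; _⊎-dec_)

data Color : Set where
  red blue : Color

opposite : Color → Color
opposite red  = blue
opposite blue = red

_≟ᶜ_ : (c d : Color) → Dec (c ≡ d)
red  ≟ᶜ red  = yes refl
red  ≟ᶜ blue = no λ ()
blue ≟ᶜ red  = no λ ()
blue ≟ᶜ blue = yes refl

-- The order of the two entries of `ends e` carries no meaning: `Incident` and
-- `Joins` are symmetric in them.  Parallel edges are distinct elements of E
-- that have the same ends.
record Graph (V E : Set) : Set where
  field
    ends     : E → V × V
    loopless : ∀ e → proj₁ (ends e) ≢ proj₂ (ends e)

  Incident : V → E → Set
  Incident v e = (v ≡ proj₁ (ends e)) ⊎ (v ≡ proj₂ (ends e))

  Joins : E → V → V → Set
  Joins e v w = (ends e ≡ (v , w)) ⊎ (ends e ≡ (w , v))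

Coloring : Set → Set
Coloring E = E → Color

module _ {V E : Set} (G : Graph V E) where
  open Graph G

  data Walk : V → V → Set where
    stop : ∀ {v} → Walk v v
    step : ∀ {v w z} (a : E) → Joins a v w → Walk w z → Walk v z

  edges : ∀ {v w} → Walk v w → List E
  edges stop         = []
  edges (step a _ W) = a ∷ edges W

  -- `wraps` compares the last edge with the first one; it is vacuous only for
  -- the walk without edges, and it excludes walks with a single edge.
  record CAT (C : Coloring E) : Set where
    field
      base        : V
      walk        : Walk base base
      distinct    : Unique (edges walk)
      alternating : Linked (λ a b → C a ≢ C b) (edges walk)
      wraps       : Connected (λ a b → C a ≢ C b)
                              (last (edges walk)) (head (edges walk))

module _ {n m : ℕ} (G : Graph (Fin n) (Fin m)) (C : Coloring (Fin m)) where
  open Graph G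

  incident? : ∀ v e → Dec (Incident v e)
  incident? v e = (v ≟ᶠ proj₁ (ends e)) ⊎-dec (v ≟ᶠ proj₂ (ends e))

  incidentEdges : Color → Fin n → List (Fin m)
  incidentEdges c v =
    filter (λ e → incident? v e ×-dec (C e ≟ᶜ c)) (allFin m)

  -- The integral points of the alternating cone; the condition x ≥ 0 is
  -- built into ℕ.
  InAlternatingCone : (Fin m → ℕ) → Set
  InAlternatingCone x =
    ∀ v → sum (map x (incidentEdges red v)) ≡ sum (map x (incidentEdges blue v))

Feasible : {E : Set} (l u f : E → ℕ) → Set
Feasible l u f = ∀ e → (l e ≤ f e) × (f e ≤ u e)

data Copy : Set where
  copy₁ copy₂ copy₃ copy₄ : Copy

module _ {V E : Set} (G : Graph V E) (C : Coloring E) (l u f : E → ℕ) where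

  -- The bounds f(e) ≤ u(e) - 1 and f(e) ≤ u(e) - 2 are inequalities between
  -- integers, so the subtraction is moved to the other side rather than
  -- truncated at 0.
  InResidual : E × Copy → Set
  InResidual (e , copy₁) = f e + 1 ≤ u e
  InResidual (e , copy₂) = f e + 2 ≤ u e
  InResidual (e , copy₃) = l e + 1 ≤ f e
  InResidual (e , copy₄) = l e + 2 ≤ f e

  -- `InResidual` is proof-irrelevant, so each copy of e occurs at most once.
  ResidualEdge : Set
  ResidualEdge = Σ (E × Copy) InResidual

  residual : Graph V ResidualEdge
  residual = record
    { ends     = λ a → Graph.ends G (proj₁ (proj₁ a))
    ; loopless = λ a → Graph.loopless G (proj₁ (proj₁ a))
    }

  copyColor : E × Copy → Color
  copyColor (e , copy₁) = C e
  copyColor (e , copy₂) = C e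
  copyColor (e , copy₃) = opposite (C e)
  copyColor (e , copy₄) = opposite (C e)

  residualColoring : Coloring ResidualEdge
  residualColoring a = copyColor (proj₁ a)

  -- As every edge of a walk in `residual` lies in E(f), this includes the
  -- assertion that the given copy belongs to E(f).
  HasResidualCATThrough : E × Copy → Set
  HasResidualCATThrough c =
    Σ[ T ∈ CAT residual residualColoring ]
      c ∈ map proj₁ (edges residual (CAT.walk T))

{-# OPTIONS --safe #-}

-- The surpluses |g - f|, coloured as in C where g exceeds f and oppositely
-- elsewhere, are capacities with equal red and blue degree at every vertex, so
-- an alternating trail that respects them cannot get stuck before it closes up.
-- A trail is a path on states (vertex, colour of the next edge).  Erasing loops
-- at repeated states leaves each state at most once, so each edge is used at
-- most once in either direction, and never more often than |g - f| permits.
-- Such a trail fits into the two copies that the residual graph offers.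
module Submission where

open import Defs
open import Data.Bool using (Bool; true; false; if_then_else_)
open import Data.Fin using (Fin)
open import Data.Fin.Properties using () renaming (_≟_ to _≟ᶠ_)
open import Data.List using (List; []; _∷_; map; filter; allFin; head; last)
open import Data.List.Membership.Propositional using (_∈_; _∉_)
open import Data.List.Membership.Propositional.Properties
  using (∈-allFin; ∈-filter⁺; ∈-filter⁻)
open import Data.List.Properties using (map-cong)
open import Data.List.Relation.Unary.All using ([]; _∷_)
open import Data.List.Relation.Unary.All.Properties using (¬Any⇒All¬; All¬⇒¬Any)
open import Data.List.Relation.Unary.Any using (here; there)
open import Data.List.Relation.Unary.AllPairs using ([]; _∷_)
open import Data.List.Relation.Unary.Linked using (Linked; []; _∷′_)
open import Data.List.Relation.Unary.Unique.Propositional using (Unique)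
import Data.List.Relation.Unary.Unique.Propositional.Properties as Unique
open import Data.Maybe using (just)
open import Data.Maybe.Relation.Binary.Connected using (Connected; just; just-nothing)
open import Data.Nat using (ℕ; zero; suc; _+_; _∸_; ∣_-_∣; _≤_; _<_; _>_; z≤n; s≤s; _≤?_)
open import Data.Nat.ListAction using (sum)
open import Data.Nat.Properties
open import Data.Nat.Solver using (module +-*-Solver)
open import Data.Product using (Σ-syntax; ∃-syntax; _×_; _,_; proj₁; proj₂)
open import Data.Product.Properties using (≡-dec)
open import Data.Sum using (inj₁; inj₂)
open import Relation.Binary.Definitions using (DecidableEquality)
open import Relation.Binary.PropositionalEquality
open import Relation.Nullary using (¬_; Dec; yes; no; does; contradiction; _×-dec_)
open import Relation.Nullary.Decidable using (dec-true; dec-false)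
open import Relation.Unary using (Decidable)

-- Colours and sums over lists.

opposite-involutive : ∀ c → opposite (opposite c) ≡ c
opposite-involutive red  = refl
opposite-involutive blue = refl

opposite-≢ : ∀ c → opposite c ≢ c
opposite-≢ red  ()
opposite-≢ blue ()

module _ {A : Set} where

  sum-map-+ : ∀ (a b : A → ℕ) xs →
    sum (map (λ x → a x + b x) xs) ≡ sum (map a xs) + sum (map b xs)
  sum-map-+ a b []       = refl
  sum-map-+ a b (x ∷ xs) rewrite sum-map-+ a b xs =
    solve 4 (λ p q r s → (p :+ q) :+ (r :+ s) := (p :+ r) :+ (q :+ s)) refl
      (a x) (b x) (sum (map a xs)) (sum (map b xs))
    where open +-*-Solver

  -- Brings sums over different incidence lists onto one index list, where they can be compared edge
  -- by edge.
  sum-map-filter : ∀ {P : A → Set} (P? : Decidable P) (r : A → ℕ) xs →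
    sum (map r (filter P? xs)) ≡ sum (map (λ x → if does (P? x) then r x else 0) xs)
  sum-map-filter P? r []       = refl
  sum-map-filter P? r (x ∷ xs) with does (P? x)
  ... | true  = cong (r x +_) (sum-map-filter P? r xs)
  ... | false = sum-map-filter P? r xs

  sum-positive⇒∈ : ∀ (r : A → ℕ) xs → 0 < sum (map r xs) → ∃[ x ] (x ∈ xs × 0 < r x)
  sum-positive⇒∈ r (x ∷ xs) pos with r x in eq
  ... | suc _ = x , here refl , subst (0 <_) (sym eq) (s≤s z≤n)
  ... | zero with y , y∈xs , ry ← sum-positive⇒∈ r xs pos = y , there y∈xs , ry

-- Multiplicities in lists.

module Counting {A : Set} (_≟_ : DecidableEquality A) where

  δ : A → A → ℕ
  δ x y = if does (x ≟ y) then 1 else 0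

  δ-refl : ∀ x → δ x x ≡ 1
  δ-refl x rewrite dec-true (x ≟ x) refl = refl

  δ-≢ : ∀ {x y} → x ≢ y → δ x y ≡ 0
  δ-≢ {x} {y} x≢y rewrite dec-false (x ≟ y) x≢y = refl

  count : A → List A → ℕ
  count x xs = sum (map (δ x) xs)

  count-∉ : ∀ {x} xs → x ∉ xs → count x xs ≡ 0
  count-∉ []       x∉ = refl
  count-∉ (y ∷ xs) x∉ =
    cong₂ _+_ (δ-≢ λ x≡y → x∉ (here x≡y)) (count-∉ xs λ x∈ → x∉ (there x∈))

  count-unique-∈ : ∀ {x xs} → Unique xs → x ∈ xs → count x xs ≡ 1
  count-unique-∈ {x} (x∉ ∷ _) (here refl) =
    cong₂ _+_ (δ-refl x) (count-∉ _ (All¬⇒¬Any x∉))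
  count-unique-∈ (y∉ ∷ xs!) (there x∈) =
    cong₂ _+_ (δ-≢ λ { refl → All¬⇒¬Any y∉ x∈ }) (count-unique-∈ xs! x∈)

  count-unique-≤1 : ∀ {xs} x → Unique xs → count x xs ≤ 1
  count-unique-≤1 x [] = z≤n
  count-unique-≤1 {y ∷ xs} x (y∉ ∷ xs!) with x ≟ y
  ... | yes refl = s≤s (≤-reflexive (count-∉ xs (All¬⇒¬Any y∉)))
  ... | no _     = count-unique-≤1 x xs!

  count-∈ : ∀ {x xs} → x ∈ xs → 1 ≤ count x xs
  count-∈ {x} (here refl) rewrite δ-refl x = s≤s z≤n
  count-∈ (there x∈)      = m≤n⇒m≤o+n _ (count-∈ x∈)

-- Alternating paths and how often they use an edge.

_≟ˢ_ : ∀ {n} → DecidableEquality (Fin n × Color)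
_≟ˢ_ = ≡-dec _≟ᶠ_ _≟ᶜ_

module AlternatingPaths {n m : ℕ} (G : Graph (Fin n) (Fin m)) (k : Coloring (Fin m)) where
  open Graph G
  open Counting (_≟ᶠ_ {m})
  open Counting (_≟ˢ_ {n}) using ()
    renaming (δ to δˢ; δ-refl to δˢ-refl; δ-≢ to δˢ-≢; count to countˢ;
              count-unique-≤1 to countˢ-unique-≤1)
  open import Data.List.Membership.DecPropositional (_≟ˢ_ {n}) using (_∈?_)

  State : Set
  State = Fin n × Color

  -- A state is a vertex with the colour that the next edge must have. Alternation is thus built in,
  -- and a path that returns to its initial state also alternates across the junction.
  data Path : State → State → Set where
    stop : ∀ {t} → Path t t
    step : ∀ {v w t} e → Joins e v w → Path (w , opposite (k e)) t → Path (v , k e) t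

  pathEdges : ∀ {s t} → Path s t → List (Fin m)
  pathEdges stop         = []
  pathEdges (step e _ W) = e ∷ pathEdges W

  -- The final state of the path is not listed.
  starts : ∀ {s t} → Path s t → List State
  starts stop                 = []
  starts (step {v = v} e _ W) = (v , k e) ∷ starts W

  joins-ends : ∀ {e v w x} → Joins e v w → Incident x e → x ≢ v → x ≡ w
  joins-ends (inj₁ refl) (inj₁ refl) x≢v = contradiction refl x≢v
  joins-ends (inj₁ refl) (inj₂ refl) x≢v = refl
  joins-ends (inj₂ refl) (inj₁ refl) x≢v = refl
  joins-ends (inj₂ refl) (inj₂ refl) x≢v = contradiction refl x≢v

  joins⇒incidentˡ : ∀ {e v w} → Joins e v w → Incident v e
  joins⇒incidentˡ (inj₁ refl) = inj₁ refl
  joins⇒incidentˡ (inj₂ refl) = inj₂ refl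

  joins⇒incidentʳ : ∀ {e v w} → Joins e v w → Incident w e
  joins⇒incidentʳ (inj₁ refl) = inj₂ refl
  joins⇒incidentʳ (inj₂ refl) = inj₁ refl

  joins⇒≢ : ∀ {e v w} → Joins e v w → v ≢ w
  joins⇒≢ {e} (inj₁ refl) v≡w = loopless e v≡w
  joins⇒≢ {e} (inj₂ refl) v≡w = loopless e (sym v≡w)

  incident⇒joins : ∀ {e v} → Incident v e → ∃[ w ] Joins e v w
  incident⇒joins (inj₁ refl) = _ , inj₁ refl
  incident⇒joins (inj₂ refl) = _ , inj₂ refl

  -- An edge is only traversed from the state at one of its two ends.
  count-pathEdges-≤ : ∀ {s t} (W : Path s t) e →
    count e (pathEdges W) ≤ countˢ (proj₁ (ends e) , k e) (starts W)
                          + countˢ (proj₂ (ends e) , k e) (starts W)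
  count-pathEdges-≤ stop e = z≤n
  count-pathEdges-≤ (step {v = v} a j W) e = begin
    δ e a + count e (pathEdges W)
      ≤⟨ +-mono-≤ (first-edge j) (count-pathEdges-≤ W e) ⟩
    (δˢ p (v , k a) + δˢ q (v , k a)) + (countˢ p (starts W) + countˢ q (starts W))
      ≡⟨ solve 4 (λ x y z w → (x :+ y) :+ (z :+ w) := (x :+ z) :+ (y :+ w)) refl
           (δˢ p (v , k a)) (δˢ q (v , k a)) (countˢ p (starts W)) (countˢ q (starts W)) ⟩
    (δˢ p (v , k a) + countˢ p (starts W)) + (δˢ q (v , k a) + countˢ q (starts W)) ∎
    where
    open ≤-Reasoning
    open +-*-Solver
    p q : State
    p = proj₁ (ends e) , k e
    q = proj₂ (ends e) , k e
    first-edge : ∀ {v w} → Joins a v w → δ e a ≤ δˢ p (v , k a) + δˢ q (v , k a)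
    first-edge j with e ≟ᶠ a
    first-edge j           | no _     = z≤n
    first-edge (inj₁ refl) | yes refl rewrite δˢ-refl p = s≤s z≤n
    first-edge (inj₂ refl) | yes refl rewrite δˢ-refl q = m≤n+m 1 _

  -- Each end of the edge supplies one state, left at most once. Two uses are what the two residual
  -- copies can absorb.
  count-pathEdges-≤2 : ∀ {s t} (W : Path s t) → Unique (starts W) →
    ∀ e → count e (pathEdges W) ≤ 2
  count-pathEdges-≤2 W W! e = ≤-trans (count-pathEdges-≤ W e)
    (+-mono-≤ (countˢ-unique-≤1 (proj₁ (ends e) , k e) W!)
              (countˢ-unique-≤1 (proj₂ (ends e) , k e) W!))

  -- Loop erasure. The extra state `s`, in practice the target, is carried along so that the suffix
  -- still avoids it.
  dropUntil : ∀ {s t u x} (W : Path t u) → Unique (s ∷ starts W) → x ∈ starts W →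
    Σ[ W′ ∈ Path x u ] (Unique (s ∷ starts W′) ×
      (∀ e → count e (pathEdges W′) ≤ count e (pathEdges W)))
  dropUntil W@(step _ _ _) W! (here refl) = W , W! , λ _ → ≤-refl
  dropUntil (step _ _ W) ((_ ∷ s∉) ∷ (_ ∷ W!)) (there x∈)
    with W′ , W′! , W′≤W ← dropUntil W (s∉ ∷ W!) x∈ =
    W′ , W′! , λ e → m≤n⇒m≤o+n _ (W′≤W e)

  -- Degrees of states.

  degree : (Fin m → ℕ) → State → ℕ
  degree r (v , c) = sum (map r (incidentEdges G k c v))

  flip : State → State
  flip (v , c) = v , opposite c

  flip-involutive : ∀ x → flip (flip x) ≡ x
  flip-involutive (v , c) = cong (v ,_) (opposite-involutive c)

  leaves? : ∀ v c → Decidable λ e → Incident v e × k e ≡ c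
  leaves? v c e = incident? G k v e ×-dec (k e ≟ᶜ c)

  degree-positive⇒edge : ∀ r {v c} → 0 < degree r (v , c) →
    ∃[ e ] (Incident v e × k e ≡ c × 0 < r e)
  degree-positive⇒edge r {v} {c} pos
    with e , e∈ , re ← sum-positive⇒∈ r _ pos
    with _ , inc , col ← ∈-filter⁻ (leaves? v c) {xs = allFin m} e∈ = e , inc , col , re

  -- Traversing `e` costs one unit of degree where it leaves and one where it arrives. The arrival
  -- is charged to the colour of `e` at `w`, which is the flip of the next state.
  count-incidentEdges : ∀ {e v w} → Joins e v w → ∀ x →
    count e (incidentEdges G k (proj₂ x) (proj₁ x)) ≡
      δˢ (v , k e) x + δˢ (w , opposite (k e)) (flip x)
  count-incidentEdges {e} {v} {w} j (z , d)
    with (v , k e) ≟ˢ (z , d) | (w , opposite (k e)) ≟ˢ (z , opposite d)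
  -- Both at once would make `e` a loop.
  ... | yes refl | yes eq = contradiction (sym (cong proj₁ eq)) (joins⇒≢ j)
  ... | yes refl | no _   = count-unique-∈ (Unique.filter⁺ (leaves? z d) (Unique.allFin⁺ m))
          (∈-filter⁺ (leaves? z d) (∈-allFin e) (joins⇒incidentˡ j , refl))
  ... | no _     | yes eq = count-unique-∈ (Unique.filter⁺ (leaves? z d) (Unique.allFin⁺ m))
          (∈-filter⁺ (leaves? z d) (∈-allFin e)
            (subst (λ y → Incident y e) (cong proj₁ eq) (joins⇒incidentʳ j) , color eq))
    where
    color : (w , opposite (k e)) ≡ (z , opposite d) → k e ≡ d
    color eq = trans (sym (opposite-involutive (k e)))
                 (trans (cong opposite (cong proj₂ eq)) (opposite-involutive d))
  ... | no v≢    | no w≢  = count-∉ _ λ e∈ → absurd (proj₂ (∈-filter⁻ (leaves? z d) {xs = allFin m} e∈))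
    where
    absurd : ¬ (Incident z e × k e ≡ d)
    absurd (inc , refl) = w≢ (cong (_, _) (sym (joins-ends j inc λ { refl → v≢ refl })))

  -- Balance along a trail and the closing of trails.

  decrement : Fin m → (Fin m → ℕ) → Fin m → ℕ
  decrement e r x = r x ∸ δ e x

  decrement-+ : ∀ e r → 0 < r e → ∀ x → r x ≡ δ e x + decrement e r x
  decrement-+ e r pos x = sym (m+[n∸m]≡n δ≤r)
    where
    δ≤r : δ e x ≤ r x
    δ≤r with e ≟ᶠ x
    ... | yes refl = pos
    ... | no _     = z≤n

  sum-decrement : ∀ e r → 0 < r e → ∀ xs →
    sum (map r xs) ≡ count e xs + sum (map (decrement e r) xs)
  sum-decrement e r pos xs =
    trans (cong sum (map-cong (decrement-+ e r pos) xs)) (sum-map-+ (δ e) (decrement e r) xs)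

  -- The capacities that remain while a trail leads from s to t: s lacks the edge
  -- by which it was left, and t the one, of the other colour, by which it was entered.
  Balanced : State → State → (Fin m → ℕ) → Set
  Balanced s t r = ∀ x →
    degree r x + δˢ s x + δˢ t (flip x) ≡ degree r (flip x) + δˢ s (flip x) + δˢ t x

  -- Removing `e` settles the excess at the old state and creates one at the new state, because
  -- colour `k e` at `w` has lost a unit.
  balanced-step : ∀ {s e v w r} → Joins e v w → 0 < r e → Balanced s (v , k e) r →
    Balanced s (w , opposite (k e)) (decrement e r)
  balanced-step {s} {e} {v} {w} {r} j pos bal x =
    -- The terms of the old state `t` are added on both sides, so that they cancel without
    -- subtraction.
    +-cancelˡ-≡ (δˢ t x + δˢ t (flip x)) _ _ (begin
      (δˢ t x + δˢ t (flip x)) + (degree r′ x + δˢ s x + δˢ t′ (flip x))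
        ≡⟨ rearrange₁ (δˢ t x) (δˢ t (flip x)) (degree r′ x) (δˢ s x) (δˢ t′ (flip x)) ⟩
      ((δˢ t x + δˢ t′ (flip x)) + degree r′ x) + δˢ s x + δˢ t (flip x)
        ≡⟨ cong (λ y → y + δˢ s x + δˢ t (flip x)) (degree-decrement x) ⟨
      degree r x + δˢ s x + δˢ t (flip x)
        ≡⟨ bal x ⟩
      degree r (flip x) + δˢ s (flip x) + δˢ t x
        ≡⟨ cong (λ y → y + δˢ s (flip x) + δˢ t x) (degree-decrement (flip x)) ⟩
      ((δˢ t (flip x) + δˢ t′ (flip (flip x))) + degree r′ (flip x)) + δˢ s (flip x) + δˢ t x
        ≡⟨ cong (λ y → ((δˢ t (flip x) + δˢ t′ y) + degree r′ (flip x)) + δˢ s (flip x) + δˢ t x)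
             (flip-involutive x) ⟩
      ((δˢ t (flip x) + δˢ t′ x) + degree r′ (flip x)) + δˢ s (flip x) + δˢ t x
        ≡⟨ rearrange₂ (δˢ t (flip x)) (δˢ t′ x) (degree r′ (flip x)) (δˢ s (flip x)) (δˢ t x) ⟩
      (δˢ t x + δˢ t (flip x)) + (degree r′ (flip x) + δˢ s (flip x) + δˢ t′ x) ∎)
    where
    open ≡-Reasoning
    open +-*-Solver
    t t′ : State
    t  = v , k e
    t′ = w , opposite (k e)
    r′ : Fin m → ℕ
    r′ = decrement e r
    degree-decrement : ∀ y → degree r y ≡ (δˢ t y + δˢ t′ (flip y)) + degree r′ y
    degree-decrement y =
      trans (sum-decrement e r pos (incidentEdges G k (proj₂ y) (proj₁ y))) (cong (_+ degree r′ y) (count-incidentEdges j y))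
    rearrange₁ : ∀ a b c d e → (a + b) + (c + d + e) ≡ ((a + e) + c) + d + b
    rearrange₁ = solve 5 (λ a b c d e → (a :+ b) :+ (c :+ d :+ e) := ((a :+ e) :+ c) :+ d :+ b) refl
    rearrange₂ : ∀ a b c d e → ((a + b) + c) + d + e ≡ (e + a) + (c + d + b)
    rearrange₂ = solve 5 (λ a b c d e → ((a :+ b) :+ c) :+ d :+ e := (e :+ a) :+ (c :+ d :+ b)) refl

  -- At `t` the right side of the balance is at least 1, while on the left only the degree can be
  -- nonzero.
  balanced⇒degree-positive : ∀ {s t r} → Balanced s t r → t ≢ s → 0 < degree r t
  balanced⇒degree-positive {s} {t} {r} bal t≢s = begin
    1                                           ≡⟨ δˢ-refl t ⟨
    δˢ t t                                      ≤⟨ m≤n+m _ _ ⟩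
    degree r (flip t) + δˢ s (flip t) + δˢ t t  ≡⟨ bal t ⟨
    degree r t + δˢ s t + δˢ t (flip t)
      ≡⟨ cong₂ (λ y z → degree r t + y + z) (δˢ-≢ {s} {t} λ s≡t → t≢s (sym s≡t))
           (δˢ-≢ {t} {flip t} λ t≡ → opposite-≢ _ (sym (cong proj₂ t≡))) ⟩
    degree r t + 0 + 0                          ≡⟨ trans (+-identityʳ _) (+-identityʳ _) ⟩
    degree r t                                  ∎
    where open ≤-Reasoning

  -- Listing `s` keeps the path from passing through its target early, so that an edge leaving `s`
  -- can be prepended without repeating a state.
  SimplePath : State → State → (Fin m → ℕ) → Set
  SimplePath t s r = Σ[ W ∈ Path t s ]
    (Unique (s ∷ starts W) × (∀ x → count x (pathEdges W) ≤ r x))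

  count-step-≤ : ∀ e r → 0 < r e → ∀ xs → (∀ x → count x xs ≤ decrement e r x) →
    ∀ x → count x (e ∷ xs) ≤ r x
  count-step-≤ e r pos xs xs≤ x = begin
    δ x e + count x xs        ≤⟨ +-monoʳ-≤ (δ x e) (xs≤ x) ⟩
    δ x e + decrement e r x   ≡⟨ cong (_+ decrement e r x) δ-sym ⟩
    δ e x + decrement e r x   ≡⟨ decrement-+ e r pos x ⟨
    r x                       ∎
    where
    open ≤-Reasoning
    δ-sym : δ x e ≡ δ e x
    δ-sym with x ≟ᶠ e
    ... | yes refl = sym (δ-refl x)
    ... | no x≢e   = sym (δ-≢ λ e≡x → x≢e (sym e≡x))

  -- Until `s` is reached, balance supplies an edge with capacity left. Each edge taken consumes one
  -- unit of the total capacity, which `fuel` exceeds.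
  simplePath : ∀ fuel {s t} r → sum (map r (allFin m)) < fuel → Balanced s t r → SimplePath t s r
  simplePath (suc fuel) {s} {t} r (s≤s total≤) bal with t ≟ˢ s
  ... | yes refl = stop , [] ∷ [] , λ _ → z≤n
  ... | no t≢s
    with e , inc , refl , pos ← degree-positive⇒edge r (balanced⇒degree-positive {s} {t} {r} bal t≢s)
    with w , j ← incident⇒joins inc
    with W , W! , W≤ ← simplePath fuel (decrement e r)
           -- The total drops by exactly one, as `e` occurs once in `allFin m`.
           (subst (_≤ fuel)
             (trans (sum-decrement e r pos (allFin m))
               (cong (_+ sum (map (decrement e r) (allFin m)))
                 (count-unique-∈ (Unique.allFin⁺ m) (∈-allFin e))))
             total≤)
           (balanced-step {s} {r = r} j pos bal)
    with t ∈? starts W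
  -- The continuation comes back to `t`: the new edge and the loop that it opens are discarded.
  ... | yes t∈
    with W′ , W′! , W′≤W ← dropUntil W W! t∈ =
    W′ , W′! , λ x → ≤-trans (W′≤W x) (≤-trans (W≤ x) (m∸n≤m (r x) (δ e x)))
  ... | no t∉ with s∉ ∷ W!′ ← W! =
    step e j W ,
    ((λ s≡t → t≢s (sym s≡t)) ∷ s∉) ∷ (¬Any⇒All¬ _ t∉ ∷ W!′) ,
    count-step-≤ e r pos (pathEdges W) W≤

  -- Before the first edge the trail starts and ends at the same state, and its two corrections
  -- cancel.
  cone⇒balanced : ∀ {r s} → InAlternatingCone G k r → Balanced s s r
  cone⇒balanced {r} {s} cone x =
    trans (cong (λ y → y + δˢ s x + δˢ s (flip x)) (degree-flip x))
      (solve 3 (λ a b c → a :+ b :+ c := a :+ c :+ b) refl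
        (degree r (flip x)) (δˢ s x) (δˢ s (flip x)))
    where
    open +-*-Solver
    degree-flip : ∀ x → degree r x ≡ degree r (flip x)
    degree-flip (v , red)  = cone v
    degree-flip (v , blue) = sym (cone v)

  -- The step through `e` is fixed first, and loops are erased only on the return path, which avoids
  -- the initial state. Hence `e` survives.
  simpleClosedPath : ∀ r → InAlternatingCone G k r → ∀ e → 0 < r e →
    ∃[ v ] ∃[ w ] Σ[ j ∈ Joins e v w ] Σ[ W ∈ Path (w , opposite (k e)) (v , k e) ]
      (Unique (starts (step e j W)) × (∀ x → count x (pathEdges (step e j W)) ≤ r x))
  simpleClosedPath r cone e pos
    -- Here `≤-refl` sets the fuel to one more than the total capacity.
    with W , W! , W≤ ← simplePath _ (decrement e r) ≤-refl
           (balanced-step {proj₁ (ends e) , k e} {r = r} (inj₁ refl) pos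
             (cone⇒balanced {r} {proj₁ (ends e) , k e} cone)) =
    _ , _ , inj₁ refl , W , W! , count-step-≤ e r pos (pathEdges W) W≤

-- The surplus between two vectors of the cone.

module Surplus {n m : ℕ} (G : Graph (Fin n) (Fin m)) (C : Coloring (Fin m))
  (f g : Fin m → ℕ) where

  surplus : Fin m → ℕ
  surplus e = ∣ f e - g e ∣

  orient : ∀ {P : Set} → Dec P → Color → Color
  orient (yes _) c = c
  orient (no _)  c = opposite c

  -- A tie counts as an increase; its surplus is 0, so no trail within capacity uses such an edge.
  surplusColoring : Coloring (Fin m)
  surplusColoring e = orient (f e ≤? g e) (C e)

  -- Incidence does not depend on the colouring. Writing it with `C` for every `K` lets one case
  -- split settle all terms of `contribution-surplus`.
  contribution : Coloring (Fin m) → (Fin m → ℕ) → Fin n → Color → Fin m → ℕ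
  contribution K r v c e =
    if does (incident? G C v e ×-dec (K e ≟ᶜ c)) then r e else 0

  sum-contribution : ∀ K r v c →
    sum (map r (incidentEdges G K c v)) ≡ sum (map (contribution K r v c) (allFin m))
  sum-contribution K r v c = sum-map-filter (λ e → incident? G C v e ×-dec (K e ≟ᶜ c)) r (allFin m)

  surplus+f : ∀ {e} → f e ≤ g e → surplus e + f e ≡ g e
  surplus+f f≤g = trans (cong (_+ _) (m≤n⇒∣m-n∣≡n∸m f≤g)) (m∸n+n≡m f≤g)

  surplus+g : ∀ {e} → g e ≤ f e → surplus e + g e ≡ f e
  surplus+g g≤f = trans (cong (_+ _) (m≤n⇒∣n-m∣≡n∸m g≤f)) (m∸n+n≡m g≤f)

  -- On each edge, surplus = g - f in its colour or f - g in the opposite colour;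
  -- all terms are moved to the side where they are positive.
  contribution-surplus : ∀ v e →
    contribution surplusColoring surplus v red e + contribution C f v red e + contribution C g v blue e
    ≡ contribution surplusColoring surplus v blue e + contribution C g v red e + contribution C f v blue e
  contribution-surplus v e with does (incident? G C v e)
  ... | false = refl
  ... | true with f e ≤? g e | C e
  ...   | yes f≤g | red  = cong (_+ 0) (surplus+f f≤g)
  ...   | yes f≤g | blue = sym (trans (cong (_+ f e) (+-identityʳ _)) (surplus+f f≤g))
  ...   | no f≰g  | red  = cong (_+ 0) (sym (surplus+g (≰⇒≥ f≰g)))
  ...   | no f≰g  | blue = trans (cong (_+ g e) (+-identityʳ _)) (surplus+g (≰⇒≥ f≰g))

  -- The difference g - f satisfies the cone equations, and swapping the colour of an edge absorbs a
  -- negative sign. The blue sums of `f` and `g` are added to both sides to stay within the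
  -- naturals.
  surplus-cone : InAlternatingCone G C f → InAlternatingCone G C g →
    InAlternatingCone G surplusColoring surplus
  surplus-cone f-cone g-cone v = +-cancelʳ-≡ (Σᶜ f blue + Σᶜ g blue) _ _ (begin
    Σˢ red + (Σᶜ f blue + Σᶜ g blue)   ≡⟨ cong (λ y → Σˢ red + (y + Σᶜ g blue)) (f-cone v) ⟨
    Σˢ red + (Σᶜ f red + Σᶜ g blue)    ≡⟨ +-assoc (Σˢ red) _ _ ⟨
    Σˢ red + Σᶜ f red + Σᶜ g blue
      ≡⟨ cong₂ _+_ (cong₂ _+_ (sum-contribution surplusColoring surplus v red)
           (sum-contribution C f v red)) (sum-contribution C g v blue) ⟩
    Σ (a red) + Σ (b f red) + Σ (b g blue)   ≡⟨ sum-map-+₃ (a red) (b f red) (b g blue) ⟨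
    Σ (λ e → a red e + b f red e + b g blue e)
      ≡⟨ cong sum (map-cong (contribution-surplus v) (allFin m)) ⟩
    Σ (λ e → a blue e + b g red e + b f blue e)
      ≡⟨ sum-map-+₃ (a blue) (b g red) (b f blue) ⟩
    Σ (a blue) + Σ (b g red) + Σ (b f blue)
      ≡⟨ cong₂ _+_ (cong₂ _+_ (sum-contribution surplusColoring surplus v blue)
           (sum-contribution C g v red)) (sum-contribution C f v blue) ⟨
    Σˢ blue + Σᶜ g red + Σᶜ f blue    ≡⟨ cong (λ y → Σˢ blue + y + Σᶜ f blue) (g-cone v) ⟩
    Σˢ blue + Σᶜ g blue + Σᶜ f blue   ≡⟨ +-assoc (Σˢ blue) _ _ ⟩
    Σˢ blue + (Σᶜ g blue + Σᶜ f blue) ≡⟨ cong (Σˢ blue +_) (+-comm (Σᶜ g blue) _) ⟩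
    Σˢ blue + (Σᶜ f blue + Σᶜ g blue) ∎)
    where
    open ≡-Reasoning
    Σ : (Fin m → ℕ) → ℕ
    Σ r = sum (map r (allFin m))
    Σˢ : Color → ℕ
    Σˢ c = sum (map surplus (incidentEdges G surplusColoring c v))
    Σᶜ : (Fin m → ℕ) → Color → ℕ
    Σᶜ r c = sum (map r (incidentEdges G C c v))
    a : Color → Fin m → ℕ
    a = contribution surplusColoring surplus v
    b : (Fin m → ℕ) → Color → Fin m → ℕ
    b r = contribution C r v
    sum-map-+₃ : ∀ p q r → Σ (λ e → p e + q e + r e) ≡ Σ p + Σ q + Σ r
    sum-map-+₃ p q r = trans (sum-map-+ (λ e → p e + q e) r (allFin m))
                         (cong (_+ Σ r) (sum-map-+ p q (allFin m)))

-- Distributing repeated edges over two copies.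

module CopyLabels {E : Set} (_≟_ : DecidableEquality E) (copyOf : E → Bool → Copy)
  (copyOf-≢ : ∀ e → copyOf e true ≢ copyOf e false) where
  open Counting _≟_
  open import Data.List.Membership.DecPropositional _≟_ using (_∈?_)

  -- The flag of `copyOf` tells whether the edge occurs again later on.
  labels : List E → List (E × Copy)
  labels []       = []
  labels (e ∷ es) = (e , copyOf e (does (e ∈? es))) ∷ labels es

  ∈-labels⇒∈ : ∀ {e c} es → (e , c) ∈ labels es → e ∈ es
  ∈-labels⇒∈ (x ∷ es) (here refl) = here refl
  ∈-labels⇒∈ (x ∷ es) (there e∈)  = there (∈-labels⇒∈ es e∈)

  repeated⇒2≤count : ∀ {e} es → (e , copyOf e true) ∈ labels es → 2 ≤ count e es
  repeated⇒2≤count (x ∷ es) (there e∈) = m≤n⇒m≤o+n _ (repeated⇒2≤count es e∈)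
  repeated⇒2≤count {e} (x ∷ es) (here eq) with x ∈? es
  repeated⇒2≤count {e} (x ∷ es) (here eq) | yes x∈ with refl ← cong proj₁ eq
    rewrite δ-refl e = s≤s (count-∈ x∈)
  repeated⇒2≤count {e} (x ∷ es) (here eq) | no _ with refl ← cong proj₁ eq =
    contradiction (cong proj₂ eq) (copyOf-≢ e)

  -- A label with flag `false` cannot recur, since the edge has no later occurrence. A recurring
  -- label with flag `true` would need a third occurrence of its edge.
  labels-unique : ∀ es → (∀ e → count e es ≤ 2) → Unique (labels es)
  labels-unique []       es≤2 = []
  labels-unique (x ∷ es) es≤2 =
    ¬Any⇒All¬ _ fresh ∷ labels-unique es λ e → ≤-trans (m≤n+m _ _) (es≤2 e)
    where
    fresh : (x , copyOf x (does (x ∈? es))) ∉ labels es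
    fresh x∈ with x ∈? es
    ... | no x∉  = x∉ (∈-labels⇒∈ es x∈)
    ... | yes _  = <⇒≱ (s≤s (repeated⇒2≤count es x∈))
                     (subst (λ y → y + count x es ≤ 2) (δ-refl x) (es≤2 x))

  -- The last occurrence always receives flag `false`. This is why the trail contains the first or
  -- third copy and not only the second or fourth.
  final∈labels : ∀ {e} es → e ∈ es → (e , copyOf e false) ∈ labels es
  final∈labels (x ∷ es) (there e∈)  = there (final∈labels es e∈)
  final∈labels (x ∷ es) (here refl) with x ∈? es
  ... | yes x∈ = there (final∈labels es x∈)
  ... | no _   = here refl

-- From closed alternating paths to CATs in the residual graph.

module ResidualTrail {n m : ℕ} (G : Graph (Fin n) (Fin m)) (C : Coloring (Fin m))
  (l u f g : Fin m → ℕ) (g-feasible : Feasible l u g) where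
  open Graph G
  open Surplus G C f g
  open AlternatingPaths G surplusColoring
  open Counting (_≟ᶠ_ {m})
  open import Data.List.Membership.DecPropositional (_≟ᶠ_ {m}) using (_∈?_)

  -- The decision selects raising or lowering `f`. The flag `true` selects the copy with the
  -- stricter bound, safe only for an edge used twice.
  copyFor : ∀ {P : Set} → Dec P → Bool → Copy
  copyFor (yes _) false = copy₁
  copyFor (yes _) true  = copy₂
  copyFor (no _)  false = copy₃
  copyFor (no _)  true  = copy₄

  copyFor-≢ : ∀ {P : Set} (P? : Dec P) → copyFor P? true ≢ copyFor P? false
  copyFor-≢ (yes _) ()
  copyFor-≢ (no _)  ()

  copyFor-yes : ∀ {P : Set} (P? : Dec P) → P → copyFor P? false ≡ copy₁
  copyFor-yes (yes _) p = refl
  copyFor-yes (no ¬p) p = contradiction p ¬p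

  copyFor-no : ∀ {P : Set} (P? : Dec P) → ¬ P → copyFor P? false ≡ copy₃
  copyFor-no (yes p) ¬p = contradiction p ¬p
  copyFor-no (no _)  ¬p = refl

  open CopyLabels _≟ᶠ_ (λ e → copyFor (f e ≤? g e)) (λ e → copyFor-≢ (f e ≤? g e))

  once : ∀ e es → 1 ≤ count e (e ∷ es)
  once e es = count-∈ {xs = e ∷ es} (here refl)

  twice : ∀ {e es} → e ∈ es → 2 ≤ count e (e ∷ es)
  twice {e} e∈ rewrite δ-refl e = s≤s (count-∈ e∈)

  below : ∀ {e i} → f e ≤ g e → i ≤ surplus e → f e + i ≤ u e
  below {e} {i} f≤g i≤ = begin
    f e + i          ≤⟨ +-monoʳ-≤ (f e) i≤ ⟩
    f e + surplus e  ≡⟨ trans (+-comm (f e) _) (surplus+f f≤g) ⟩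
    g e              ≤⟨ proj₂ (g-feasible e) ⟩
    u e              ∎
    where open ≤-Reasoning

  above : ∀ {e i} → g e ≤ f e → i ≤ surplus e → l e + i ≤ f e
  above {e} {i} g≤f i≤ = begin
    l e + i          ≤⟨ +-mono-≤ (proj₁ (g-feasible e)) i≤ ⟩
    g e + surplus e  ≡⟨ trans (+-comm (g e) _) (surplus+g g≤f) ⟩
    f e              ∎
    where open ≤-Reasoning

  -- An edge that occurs again has surplus at least 2. As `g` respects the bounds, moving `f` by up
  -- to the surplus towards `g` does not overshoot them.
  inResidual : ∀ e es → count e (e ∷ es) ≤ surplus e →
    InResidual G C l u f (e , copyFor (f e ≤? g e) (does (e ∈? es)))
  inResidual e es es≤ with f e ≤? g e | e ∈? es
  ... | yes f≤g | no _   = below f≤g (≤-trans (once e es) es≤)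
  ... | yes f≤g | yes e∈ = below f≤g (≤-trans (twice e∈) es≤)
  ... | no f≰g  | no _   = above (≰⇒≥ f≰g) (≤-trans (once e es) es≤)
  ... | no f≰g  | yes e∈ = above (≰⇒≥ f≰g) (≤-trans (twice e∈) es≤)

  copyColor-copyFor : ∀ e b →
    copyColor G C l u f (e , copyFor (f e ≤? g e) b) ≡ surplusColoring e
  copyColor-copyFor e b with f e ≤? g e
  copyColor-copyFor e false | yes _ = refl
  copyColor-copyFor e true  | yes _ = refl
  copyColor-copyFor e false | no _  = refl
  copyColor-copyFor e true  | no _  = refl

  Fits : List (Fin m) → Set
  Fits es = ∀ e → count e es ≤ surplus e

  fits-tail : ∀ e es → Fits (e ∷ es) → Fits es
  fits-tail a es fits e = ≤-trans (m≤n+m _ (δ e a)) (fits e)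

  residualEdge : ∀ e es → Fits (e ∷ es) → ResidualEdge G C l u f
  residualEdge e es fits = (e , copyFor (f e ≤? g e) (does (e ∈? es))) , inResidual e es (fits e)

  col : Coloring (ResidualEdge G C l u f)
  col = residualColoring G C l u f

  col-residualEdge : ∀ e es fits → col (residualEdge e es fits) ≡ surplusColoring e
  col-residualEdge e es fits = copyColor-copyFor e (does (e ∈? es))

  -- The state after `e` has the opposite colour, and `lift-head` and `lift-last` ask for the
  -- opposite of that.
  col-residualEdge′ : ∀ e es fits →
    col (residualEdge e es fits) ≡ opposite (opposite (surplusColoring e))
  col-residualEdge′ e es fits =
    trans (col-residualEdge e es fits) (sym (opposite-involutive (surplusColoring e)))

  R : Graph (Fin n) (ResidualEdge G C l u f)
  R = residual G C l u f

  lift : ∀ {s t} (W : Path s t) → Fits (pathEdges W) → Walk R (proj₁ s) (proj₁ t)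
  lift stop         fits = stop
  lift (step e j W) fits = step (residualEdge e (pathEdges W) fits) j (lift W (fits-tail e (pathEdges W) fits))

  liftEdges : ∀ {s t} (W : Path s t) → Fits (pathEdges W) → List (ResidualEdge G C l u f)
  liftEdges W fits = edges R (lift W fits)

  map-liftEdges : ∀ {s t} (W : Path s t) fits → map proj₁ (liftEdges W fits) ≡ labels (pathEdges W)
  map-liftEdges stop         fits = refl
  map-liftEdges (step e j W) fits = cong (proj₁ (residualEdge e (pathEdges W) fits) ∷_)
    (map-liftEdges W (fits-tail e (pathEdges W) fits))

  Alternate : (a b : ResidualEdge G C l u f) → Set
  Alternate a b = col a ≢ col b

  alternate : ∀ a b c → col a ≡ opposite c → col b ≡ c → Alternate a b
  alternate a b c a≡ b≡ a≡b = opposite-≢ c (trans (sym a≡) (trans a≡b b≡))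

  lift-head : ∀ {s t} (W : Path s t) fits a → col a ≡ opposite (proj₂ s) →
    Connected Alternate (just a) (head (liftEdges W fits))
  lift-head stop         fits a a≡ = just-nothing
  lift-head (step e j W) fits a a≡ = just
    (alternate a (residualEdge e (pathEdges W) fits) (surplusColoring e) a≡
      (col-residualEdge e (pathEdges W) fits))

  lift-linked : ∀ {s t} (W : Path s t) fits → Linked Alternate (liftEdges W fits)
  lift-linked stop         fits = []
  lift-linked (step e j W) fits =
    lift-head W (fits-tail e (pathEdges W) fits) (residualEdge e (pathEdges W) fits)
      (col-residualEdge′ e (pathEdges W) fits)
    ∷′ lift-linked W (fits-tail e (pathEdges W) fits)

  -- The preceding edge `a` varies in the induction, so that at `stop` it is the last edge of the
  -- trail.
  lift-last : ∀ {s t} (W : Path s t) fits a b → col a ≡ opposite (proj₂ s) → col b ≡ proj₂ t →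
    Connected Alternate (last (a ∷ liftEdges W fits)) (just b)
  lift-last stop         fits a b a≡ b≡ = just (alternate a b _ a≡ b≡)
  lift-last (step e j W) fits a b a≡ b≡ =
    lift-last W (fits-tail e (pathEdges W) fits) (residualEdge e (pathEdges W) fits) b
      (col-residualEdge′ e (pathEdges W) fits) b≡

  closedPath⇒CAT : ∀ {e v w} (j : Joins e v w)
    (W : Path (w , opposite (surplusColoring e)) (v , surplusColoring e)) →
    Unique (starts (step e j W)) → Fits (pathEdges (step e j W)) →
    HasResidualCATThrough G C l u f (e , copyFor (f e ≤? g e) false)
  closedPath⇒CAT {e} {v} j W Q! fits =
    record
      { base        = v
      ; walk        = lift Q fits
      ; distinct    = Unique.map⁻ (subst Unique (sym (map-liftEdges Q fits))
                        (labels-unique (pathEdges Q) (count-pathEdges-≤2 Q Q!)))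
      ; alternating = lift-linked Q fits
      -- The first edge plays both roles: it precedes `W`, and it follows `W` after the return.
      ; wraps       = lift-last W (fits-tail e (pathEdges W) fits) a a
                        (col-residualEdge′ e (pathEdges W) fits)
                        (col-residualEdge e (pathEdges W) fits)
      } ,
    subst ((e , copyFor (f e ≤? g e) false) ∈_) (sym (map-liftEdges Q fits))
      (final∈labels (pathEdges Q) (here refl))
    where
    Q = step e j W
    a = residualEdge e (pathEdges W) fits

  residualCAT : InAlternatingCone G C f → InAlternatingCone G C g → ∀ e → f e ≢ g e →
    HasResidualCATThrough G C l u f (e , copyFor (f e ≤? g e) false)
  residualCAT f-cone g-cone e f≢g =
    let _ , _ , j , W , Q! , fits = simpleClosedPath surplus (surplus-cone f-cone g-cone) e
          (n≢0⇒n>0 λ eq → f≢g (∣m-n∣≡0⇒m≡n eq))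
    in closedPath⇒CAT j W Q! fits

theorem3p2 : ∀ {n m : ℕ} (G : Graph (Fin n) (Fin m)) (C : Coloring (Fin m))
    (l u : Fin m → ℕ) → (∀ e → l e ≤ u e) →
    (f : Fin m → ℕ) → InAlternatingCone G C f → ¬ Feasible l u f →
    (Σ[ g ∈ (Fin m → ℕ) ] (InAlternatingCone G C g × Feasible l u g)) →
    ∀ (e : Fin m) →
    (f e < l e → HasResidualCATThrough G C l u f (e , copy₁)) ×
    (f e > u e → HasResidualCATThrough G C l u f (e , copy₃))
theorem3p2 G C l u _ f f-cone _ (g , g-cone , g-feasible) e = deficient , excessive
  where
  open ResidualTrail G C l u f g g-feasible

  deficient : f e < l e → HasResidualCATThrough G C l u f (e , copy₁)
  deficient f<l = subst (λ c → HasResidualCATThrough G C l u f (e , c))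
    (copyFor-yes (f e ≤? g e) (<⇒≤ f<g)) (residualCAT f-cone g-cone e (<⇒≢ f<g))
    where
    f<g : f e < g e
    f<g = <-≤-trans f<l (proj₁ (g-feasible e))

  excessive : f e > u e → HasResidualCATThrough G C l u f (e , copy₃)
  excessive f>u = subst (λ c → HasResidualCATThrough G C l u f (e , c))
    (copyFor-no (f e ≤? g e) (<⇒≱ g<f)) (residualCAT f-cone g-cone e (≢-sym (<⇒≢ g<f)))
    where
    g<f : g e < f e
    g<f = ≤-<-trans (proj₂ (g-feasible e)) f>u
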